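{- Let $R$ be a commutative ring with unity, let $m\ge 1$ be an integer, and let $\lambda_1,\lambda_3:\mathbb N\times\mathbb Z\to R$ be two families with triangular support of order $m$ such that $\lambda_1(n,0)\,\lambda_3(n,0)=1$ for all $n\in\mathbb N$. Let $$f_n(x)=\sum_{b=0}^{w_m(n)}\lambda_1(n,b)\,x^{n-mb}\in R[x]\qquad(n\in\mathbb N).$$ Then, for every $n\in\mathbb N$, the following are equivalent: (i) for all $1\le k\le w_m(n)$, $$\sum_{b=0}^{k}\lambda_3(n,b)\,\lambda_1(n-mb,k-b)=0;$$ (ii) $$x^n=\sum_{b=0}^{w_m(n)}\lambda_3(n,b)\,f_{n-mb}(x).$$
   Context: $\mathbb N=\{0,1,2,\dots\}$ and $w_m(n)=\lfloor n/m\rfloor$. A family $\lambda:\mathbb N\times\mathbb Z\to R$ has triangular support of order $m$ (written $\lambda\in\Delta_m$) if $\lambda(n,k)=0$ whenever $k<0$ or $k>w_m(n)$. -}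

module Defs where

open import Algebra.Bundles using (CommutativeRing; RawMonoid; RawSemiring)
import Algebra.Definitions.RawMonoid as RawMonoidDefs
import Algebra.Definitions.RawSemiring as RawSemiringDefs
open import Data.Fin.Base using (toℕ)
open import Data.Integer.Base as ℤ using (ℤ; +_)
open import Data.List.Base using (List; []; _∷_; map)
open import Data.Nat.Base as ℕ using (ℕ; zero; suc; NonZero)
open import Data.Nat.DivMod using (_/_)
open import Data.Sum.Base using (_⊎_)
open import Level using (Level)

private
  variable
    c ℓ : Level

w : (m : ℕ) .{{_ : NonZero m}} → ℕ → ℕ
w m n = n / m

-- The upper limit is inclusive: Σ≤ M n f = f 0 + f 1 + ⋯ + f n.
Σ≤ : (M : RawMonoid c ℓ) → ℕ → (ℕ → RawMonoid.Carrier M) → RawMonoid.Carrier M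
Σ≤ M n f = RawMonoidDefs.sum M {suc n} (λ i → f (toℕ i))

-- R[x].  A polynomial is the list of its coefficients, constant term first.
-- Trailing zeros are allowed, so equality is equality of all coefficients.
module Polynomial (R : CommutativeRing c ℓ) where

  open CommutativeRing R

  infix  4 _≈ₚ_
  infixl 6 _+ₚ_
  infixl 7 _*ₚ_ _·_

  Poly : Set c
  Poly = List Carrier

  coeff : Poly → ℕ → Carrier
  coeff []      _       = 0#
  coeff (a ∷ p) zero    = a
  coeff (a ∷ p) (suc i) = coeff p i

  _≈ₚ_ : Poly → Poly → Set ℓ
  p ≈ₚ q = ∀ i → coeff p i ≈ coeff q i

  _+ₚ_ : Poly → Poly → Poly
  []      +ₚ q       = q
  (a ∷ p) +ₚ []      = a ∷ p
  (a ∷ p) +ₚ (b ∷ q) = (a + b) ∷ (p +ₚ q)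

  _·_ : Carrier → Poly → Poly
  a · p = map (a *_) p

  -- (a + x p) q = a q + x (p q)
  _*ₚ_ : Poly → Poly → Poly
  []      *ₚ q = []
  (a ∷ p) *ₚ q = a · q +ₚ (0# ∷ p *ₚ q)

  X : Poly
  X = 0# ∷ 1# ∷ []

  polyRawSemiring : RawSemiring c ℓ
  polyRawSemiring = record
    { Carrier = Poly
    ; _≈_     = _≈ₚ_
    ; _+_     = _+ₚ_
    ; _*_     = _*ₚ_
    ; 0#      = []
    ; 1#      = 1# ∷ []
    }

  open RawSemiringDefs polyRawSemiring public using (_^_)

module Triangular (R : CommutativeRing c ℓ) where

  open CommutativeRing R
  open Polynomial R public

  Family : Set c
  Family = ℕ → ℤ → Carrier

  -- Δ m is the set of families with triangular support of order m.
  Δ : (m : ℕ) .{{_ : NonZero m}} → Family → Set ℓ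
  Δ m F = ∀ n k → k ℤ.< + 0 ⊎ k ℤ.> + w m n → F n k ≈ 0#

  ∑ : ℕ → (ℕ → Carrier) → Carrier
  ∑ = Σ≤ +-rawMonoid

  ∑ₚ : ℕ → (ℕ → Poly) → Poly
  ∑ₚ = Σ≤ (RawSemiring.+-rawMonoid polyRawSemiring)

  syntax ∑  n (λ b → t) = ∑[ b ≤ n ] t
  syntax ∑ₚ n (λ b → t) = ∑ₚ[ b ≤ n ] t

  -- Truncated subtraction is exact here, since b ≤ w m n gives m * b ≤ n.
  f : (m : ℕ) .{{_ : NonZero m}} → Family → ℕ → Poly
  f m F n = ∑ₚ[ b ≤ w m n ] (F n (+ b) · X ^ (n ℕ.∸ m ℕ.* b))

-- Collecting equal powers of x turns the right-hand side of (ii) into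
-- Σ_{k ≤ w n} S k · x^(n − mk), where S k is the sum in (i).  Since S 0 = 1 and
-- the exponents n − mk are pairwise distinct, this is x^n exactly when the
-- other S k vanish.
{-# OPTIONS --safe #-}
module Submission where

open import Defs
open import Algebra.Bundles using (CommutativeRing)
import Algebra.Properties.CommutativeMonoid.Sum as CommutativeMonoidSum
import Algebra.Properties.Semiring.Sum as SemiringSum
open import Data.Fin.Base using (toℕ)
open import Data.Fin.Properties using (toℕ≤pred[n])
open import Data.Integer.Base as ℤ using (+_)
import Data.Integer.Properties as ℤ
open import Data.List.Base using ([]; _∷_)
open import Data.Nat.Base as ℕ using (ℕ; zero; suc; NonZero; z≤n; s≤s)
open import Data.Nat.DivMod using (/-congˡ; m/n*n≤m; [m∸n*o]/o≡m/o∸n)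
import Data.Nat.Properties as ℕ
open import Function.Base using (_∘_)
open import Function.Bundles using (_⇔_; mk⇔)
open import Relation.Binary.PropositionalEquality as ≡ using (_≡_; _≢_)
open import Relation.Nullary using (contradiction)

-- Fixes the length of the sum defining `f m λ₁ (n ∸ m * b)`: as `b` runs up to `w m n`, the index
-- pairs `(b , c)` fill the triangle `b + c ≤ w m n`.
w-∸ : ∀ m .{{_ : NonZero m}} n b → w m (n ℕ.∸ m ℕ.* b) ≡ w m n ℕ.∸ b
w-∸ m n b = ≡.trans (/-congˡ (≡.cong (n ℕ.∸_) (ℕ.*-comm m b))) ([m∸n*o]/o≡m/o∸n n b m)

≤w⇒*≤ : ∀ m .{{_ : NonZero m}} {n b} → b ℕ.≤ w m n → m ℕ.* b ℕ.≤ n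
≤w⇒*≤ m {n} b≤w = ℕ.≤-trans (ℕ.*-monoʳ-≤ m b≤w)
  (ℕ.≤-trans (ℕ.≤-reflexive (ℕ.*-comm m (w m n))) (m/n*n≤m n m))

-- The bounds give `m * j ≤ n` and `m * k ≤ n`, so neither subtraction truncates and both `n` and
-- the nonzero factor `m` cancel.
∸-*-injective : ∀ m .{{_ : NonZero m}} {n j k} → j ℕ.≤ w m n → k ℕ.≤ w m n →
                n ℕ.∸ m ℕ.* j ≡ n ℕ.∸ m ℕ.* k → j ≡ k
∸-*-injective m {n} {j} {k} j≤w k≤w eq =
  ℕ.*-cancelˡ-≡ j k m (ℕ.∸-cancelˡ-≡ (≤w⇒*≤ m j≤w) (≤w⇒*≤ m k≤w) eq)

∸-*-distrib-+ : ∀ m n b c → n ℕ.∸ m ℕ.* b ℕ.∸ m ℕ.* c ≡ n ℕ.∸ m ℕ.* (b ℕ.+ c)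
∸-*-distrib-+ m n b c = ≡.trans (ℕ.∸-+-assoc n (m ℕ.* b) (m ℕ.* c))
  (≡.cong (n ℕ.∸_) (≡.sym (ℕ.*-distribˡ-+ m b c)))

-- Reindexing along antidiagonals produces the natural number `k ∸ b`, whereas (i) evaluates `λ₁` at
-- an integer difference.
+∸≡- : ∀ {b k} → b ℕ.≤ k → + (k ℕ.∸ b) ≡ + k ℤ.- + b
+∸≡- {b} {k} b≤k = ≡.sym (≡.trans (ℤ.m-n≡m⊖n k b) (ℤ.⊖-≥ b≤k))

module _ {c ℓ} (R : CommutativeRing c ℓ) where

  open CommutativeRing R
  open Triangular R
  open CommutativeMonoidSum +-commutativeMonoid using (sum-cong-≋; ∑-distrib-+)
  open SemiringSum semiring using (*-distribˡ-sum; *-distribʳ-sum)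
  open import Relation.Binary.Reasoning.Setoid setoid

  ∑-cong : ∀ n {f g : ℕ → Carrier} → (∀ b → b ℕ.≤ n → f b ≈ g b) → ∑ n f ≈ ∑ n g
  ∑-cong n f≈g = sum-cong-≋ {suc n} λ i → f≈g (toℕ i) (toℕ≤pred[n] i)

  ∑-zero : ∀ n (f : ℕ → Carrier) → (∀ b → b ℕ.≤ n → f b ≈ 0#) → ∑ n f ≈ 0#
  ∑-zero zero    f f≈0 = trans (+-identityʳ _) (f≈0 0 z≤n)
  ∑-zero (suc n) f f≈0 = trans
    (+-cong (f≈0 0 z≤n) (∑-zero n (f ∘ suc) λ b b≤n → f≈0 (suc b) (s≤s b≤n)))
    (+-identityʳ 0#)

  ∑-single : ∀ n {k} (f : ℕ → Carrier) → k ℕ.≤ n →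
             (∀ b → b ℕ.≤ n → b ≢ k → f b ≈ 0#) → ∑ n f ≈ f k
  ∑-single zero    f z≤n       f≈0 = +-identityʳ _
  ∑-single (suc n) f z≤n       f≈0 = trans
    (+-congˡ (∑-zero n (f ∘ suc) λ b b≤n → f≈0 (suc b) (s≤s b≤n) λ ()))
    (+-identityʳ _)
  ∑-single (suc n) f (s≤s k≤n) f≈0 = trans
    (+-cong (f≈0 0 z≤n λ ())
            (∑-single n (f ∘ suc) k≤n λ b b≤n b≢k → f≈0 (suc b) (s≤s b≤n) (b≢k ∘ ℕ.suc-injective)))
    (+-identityˡ _)

  -- Induction on `n`, peeling off the row `b = 0`. Its entry `c = 0` is the antidiagonal `k = 0`,
  -- and its entry `c = k + 1` opens the antidiagonal `k + 1`; the remaining rows form a triangle of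
  -- size `n`.
  ∑-triangle : ∀ n (h : ℕ → ℕ → Carrier) →
    ∑[ b ≤ n ] (∑[ c ≤ n ℕ.∸ b ] h b c) ≈ ∑[ k ≤ n ] (∑[ b ≤ k ] h b (k ℕ.∸ b))
  ∑-triangle zero    h = refl
  ∑-triangle (suc n) h = begin
    ∑ (suc n) (h 0) + ∑[ b ≤ n ] (∑[ c ≤ n ℕ.∸ b ] h (suc b) c)
      ≈⟨ +-congˡ (∑-triangle n (h ∘ suc)) ⟩
    (h 0 0 + ∑[ k ≤ n ] h 0 (suc k)) + ∑[ k ≤ n ] (∑[ b ≤ k ] h (suc b) (k ℕ.∸ b))
      ≈⟨ +-assoc _ _ _ ⟩
    h 0 0 + (∑[ k ≤ n ] h 0 (suc k) + ∑[ k ≤ n ] (∑[ b ≤ k ] h (suc b) (k ℕ.∸ b)))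
      -- A one-term sum unfolds with a final `+ 0#`, so the antidiagonal `k = 0` is `h 0 0 + 0#`.
      ≈⟨ +-cong (+-identityʳ _) (∑-distrib-+ {suc n}
           (h 0 ∘ suc ∘ toℕ) (λ i → ∑[ b ≤ toℕ i ] h (suc b) (toℕ i ℕ.∸ b))) ⟨
    (h 0 0 + 0#) + ∑[ k ≤ n ] (h 0 (suc k) + ∑[ b ≤ k ] h (suc b) (k ℕ.∸ b)) ∎

  coeff-+ₚ : ∀ p q i → coeff (p +ₚ q) i ≈ coeff p i + coeff q i
  coeff-+ₚ []      q       i       = sym (+-identityˡ _)
  coeff-+ₚ (a ∷ p) []      i       = sym (+-identityʳ _)
  coeff-+ₚ (a ∷ p) (b ∷ q) zero    = refl
  coeff-+ₚ (a ∷ p) (b ∷ q) (suc i) = coeff-+ₚ p q i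

  coeff-· : ∀ a p i → coeff (a · p) i ≈ a * coeff p i
  coeff-· a []      i       = sym (zeroʳ a)
  coeff-· a (b ∷ p) zero    = refl
  coeff-· a (b ∷ p) (suc i) = coeff-· a p i

  coeff-∑ₚ : ∀ n (p : ℕ → Poly) i → coeff (∑ₚ n p) i ≈ ∑[ b ≤ n ] coeff (p b) i
  coeff-∑ₚ zero    p i = coeff-+ₚ (p 0) [] i
  coeff-∑ₚ (suc n) p i = trans (coeff-+ₚ (p 0) _ i) (+-congˡ (coeff-∑ₚ n (p ∘ suc) i))

  coeff-X*-zero : ∀ p → coeff (X *ₚ p) 0 ≈ 0#
  coeff-X*-zero p = begin
    coeff (X *ₚ p) 0        ≈⟨ coeff-+ₚ (0# · p) _ 0 ⟩
    coeff (0# · p) 0 + 0#   ≈⟨ +-identityʳ _ ⟩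
    coeff (0# · p) 0        ≈⟨ coeff-· 0# p 0 ⟩
    0# * coeff p 0          ≈⟨ zeroˡ _ ⟩
    0#                      ∎

  coeff-[0#] : ∀ i → coeff (0# ∷ []) i ≈ 0#
  coeff-[0#] zero    = refl
  coeff-[0#] (suc i) = refl

  -- `X *ₚ p` unfolds to `0# · p +ₚ (0# ∷ (1# · p +ₚ (0# ∷ [])))`. The first summand and the
  -- innermost list have only zero coefficients; the outer `0# ∷` is the shift by one.
  coeff-X*-suc : ∀ p i → coeff (X *ₚ p) (suc i) ≈ coeff p i
  coeff-X*-suc p i = begin
    coeff (X *ₚ p) (suc i)
      ≈⟨ coeff-+ₚ (0# · p) _ (suc i) ⟩
    coeff (0# · p) (suc i) + coeff (1# · p +ₚ (0# ∷ [])) i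
      ≈⟨ +-cong (coeff-· 0# p (suc i)) (coeff-+ₚ (1# · p) _ i) ⟩
    0# * coeff p (suc i) + (coeff (1# · p) i + coeff (0# ∷ []) i)
      ≈⟨ +-cong (zeroˡ _) (+-cong (coeff-· 1# p i) (coeff-[0#] i)) ⟩
    0# + (1# * coeff p i + 0#)
      ≈⟨ trans (+-identityˡ _) (+-identityʳ _) ⟩
    1# * coeff p i
      ≈⟨ *-identityˡ _ ⟩
    coeff p i ∎

  coeff-X^-≡ : ∀ e → coeff (X ^ e) e ≈ 1#
  coeff-X^-≡ zero    = refl
  coeff-X^-≡ (suc e) = trans (coeff-X*-suc (X ^ e) e) (coeff-X^-≡ e)

  coeff-X^-≢ : ∀ e i → e ≢ i → coeff (X ^ e) i ≈ 0#
  coeff-X^-≢ zero    zero    e≢i = contradiction ≡.refl e≢i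
  coeff-X^-≢ zero    (suc i) e≢i = refl
  coeff-X^-≢ (suc e) zero    e≢i = coeff-X*-zero (X ^ e)
  coeff-X^-≢ (suc e) (suc i) e≢i =
    trans (coeff-X*-suc (X ^ e) i) (coeff-X^-≢ e i (e≢i ∘ ≡.cong suc))

  module _ (m : ℕ) .{{_ : NonZero m}} (λ₁ λ₃ : Family) (n : ℕ) where

    -- The `S k` of the overview, taken for `k = 0` as well.
    convolution : ℕ → Carrier
    convolution k =
      ∑[ b ≤ k ] (λ₃ n (+ b) * λ₁ (n ℕ.∸ m ℕ.* b) (+ k ℤ.- + b))

    expansion : Poly
    expansion = ∑ₚ[ b ≤ w m n ] (λ₃ n (+ b) · f m λ₁ (n ℕ.∸ m ℕ.* b))

    private
      -- The share of the pair `(b , c)` in the coefficient at `i`. The exponent is written through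
      -- `b + c` so that it is visibly constant on antidiagonals.
      term : ℕ → ℕ → ℕ → Carrier
      term i b c = λ₃ n (+ b) * λ₁ (n ℕ.∸ m ℕ.* b) (+ c) * coeff (X ^ (n ℕ.∸ m ℕ.* (b ℕ.+ c))) i

    coeff-row : ∀ i b → coeff (λ₃ n (+ b) · f m λ₁ (n ℕ.∸ m ℕ.* b)) i ≈
                        ∑[ c ≤ w m n ℕ.∸ b ] term i b c
    coeff-row i b = begin
      coeff (a · f m λ₁ n′) i
        ≈⟨ coeff-· a (f m λ₁ n′) i ⟩
      a * coeff (f m λ₁ n′) i
        ≈⟨ *-congˡ (coeff-∑ₚ (w m n′) (λ c → λ₁ n′ (+ c) · X ^ (n′ ℕ.∸ m ℕ.* c)) i) ⟩
      a * ∑[ c ≤ w m n′ ] coeff (λ₁ n′ (+ c) · X ^ (n′ ℕ.∸ m ℕ.* c)) i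
        ≡⟨ ≡.cong (λ v → a * ∑[ c ≤ v ] coeff (λ₁ n′ (+ c) · X ^ (n′ ℕ.∸ m ℕ.* c)) i)
             (w-∸ m n b) ⟩
      a * ∑[ c ≤ w m n ℕ.∸ b ] coeff (λ₁ n′ (+ c) · X ^ (n′ ℕ.∸ m ℕ.* c)) i
        ≈⟨ *-distribˡ-sum {suc (w m n ℕ.∸ b)} a
             (λ j → coeff (λ₁ n′ (+ toℕ j) · X ^ (n′ ℕ.∸ m ℕ.* toℕ j)) i) ⟩
      ∑[ c ≤ w m n ℕ.∸ b ] (a * coeff (λ₁ n′ (+ c) · X ^ (n′ ℕ.∸ m ℕ.* c)) i)
        ≈⟨ ∑-cong (w m n ℕ.∸ b) (λ c _ → entry c) ⟩
      ∑[ c ≤ w m n ℕ.∸ b ] term i b c ∎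
      where
      a  = λ₃ n (+ b)
      n′ = n ℕ.∸ m ℕ.* b

      entry : ∀ c → a * coeff (λ₁ n′ (+ c) · X ^ (n′ ℕ.∸ m ℕ.* c)) i ≈ term i b c
      entry c = begin
        a * coeff (λ₁ n′ (+ c) · X ^ (n′ ℕ.∸ m ℕ.* c)) i
          ≈⟨ *-congˡ (coeff-· _ (X ^ (n′ ℕ.∸ m ℕ.* c)) i) ⟩
        a * (λ₁ n′ (+ c) * coeff (X ^ (n′ ℕ.∸ m ℕ.* c)) i)
          ≈⟨ *-assoc _ _ _ ⟨
        a * λ₁ n′ (+ c) * coeff (X ^ (n′ ℕ.∸ m ℕ.* c)) i
          ≡⟨ ≡.cong (λ e → a * λ₁ n′ (+ c) * coeff (X ^ e) i) (∸-*-distrib-+ m n b c) ⟩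
        term i b c ∎

    -- On `b + c = k` the power of x is always `X ^ (n ∸ m * k)`, so its coefficient factors out on
    -- the right.
    coeff-antidiagonal : ∀ i k → ∑[ b ≤ k ] term i b (k ℕ.∸ b) ≈
                                 convolution k * coeff (X ^ (n ℕ.∸ m ℕ.* k)) i
    coeff-antidiagonal i k = trans
      -- Two rewrites at once: `k ∸ b` becomes an integer difference in the argument of `λ₁`, and
      -- `b + (k ∸ b)` collapses to `k` in the exponent.
      (∑-cong k λ b b≤k → reflexive (≡.cong₂
        (λ z e → λ₃ n (+ b) * λ₁ (n ℕ.∸ m ℕ.* b) z * coeff (X ^ (n ℕ.∸ m ℕ.* e)) i)
        (+∸≡- b≤k) (ℕ.m+[n∸m]≡n b≤k)))
      (sym (*-distribʳ-sum {suc k} (coeff (X ^ (n ℕ.∸ m ℕ.* k)) i)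
        λ j → λ₃ n (+ toℕ j) * λ₁ (n ℕ.∸ m ℕ.* toℕ j) (+ k ℤ.- + toℕ j)))

    coeff-expansion : ∀ i → coeff expansion i ≈
      ∑[ k ≤ w m n ] (convolution k * coeff (X ^ (n ℕ.∸ m ℕ.* k)) i)
    coeff-expansion i = begin
      coeff expansion i
        ≈⟨ coeff-∑ₚ (w m n) (λ b → λ₃ n (+ b) · f m λ₁ (n ℕ.∸ m ℕ.* b)) i ⟩
      ∑[ b ≤ w m n ] coeff (λ₃ n (+ b) · f m λ₁ (n ℕ.∸ m ℕ.* b)) i
        ≈⟨ ∑-cong (w m n) (λ b _ → coeff-row i b) ⟩
      ∑[ b ≤ w m n ] (∑[ c ≤ w m n ℕ.∸ b ] term i b c)
        ≈⟨ ∑-triangle (w m n) (term i) ⟩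
      ∑[ k ≤ w m n ] (∑[ b ≤ k ] term i b (k ℕ.∸ b))
        ≈⟨ ∑-cong (w m n) (λ k _ → coeff-antidiagonal i k) ⟩
      ∑[ k ≤ w m n ] (convolution k * coeff (X ^ (n ℕ.∸ m ℕ.* k)) i) ∎

    -- The exponents `n ∸ m * j` with `j ≤ w m n` are pairwise distinct, so only `j = k` contributes
    -- at this position.
    coeff-expansion-∸ : ∀ {k} → k ℕ.≤ w m n → coeff expansion (n ℕ.∸ m ℕ.* k) ≈ convolution k
    coeff-expansion-∸ {k} k≤w = begin
      coeff expansion (n ℕ.∸ m ℕ.* k)
        ≈⟨ coeff-expansion _ ⟩
      ∑[ j ≤ w m n ] (convolution j * coeff (X ^ (n ℕ.∸ m ℕ.* j)) (n ℕ.∸ m ℕ.* k))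
        ≈⟨ ∑-single (w m n) (λ j → convolution j * coeff (X ^ (n ℕ.∸ m ℕ.* j)) (n ℕ.∸ m ℕ.* k)) k≤w
             (λ j j≤w j≢k → trans (*-congˡ (coeff-X^-≢ _ _ (j≢k ∘ ∸-*-injective m j≤w k≤w))) (zeroʳ _)) ⟩
      convolution k * coeff (X ^ (n ℕ.∸ m ℕ.* k)) (n ℕ.∸ m ℕ.* k)
        ≈⟨ *-congˡ (coeff-X^-≡ (n ℕ.∸ m ℕ.* k)) ⟩
      convolution k * 1#
        ≈⟨ *-identityʳ _ ⟩
      convolution k ∎

    convolution-zero : λ₁ n (+ 0) * λ₃ n (+ 0) ≈ 1# → convolution 0 ≈ 1#
    convolution-zero inv = begin
      λ₃ n (+ 0) * λ₁ (n ℕ.∸ m ℕ.* 0) (+ 0) + 0#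
        ≈⟨ +-identityʳ _ ⟩
      λ₃ n (+ 0) * λ₁ (n ℕ.∸ m ℕ.* 0) (+ 0)
        -- `+ 0 - + 0` computes to `+ 0`, but `m * 0` is stuck on the variable `m` and has to be
        -- rewritten.
        ≡⟨ ≡.cong (λ e → λ₃ n (+ 0) * λ₁ (n ℕ.∸ e) (+ 0)) (ℕ.*-zeroʳ m) ⟩
      λ₃ n (+ 0) * λ₁ n (+ 0)
        ≈⟨ *-comm _ _ ⟩
      λ₁ n (+ 0) * λ₃ n (+ 0)
        ≈⟨ inv ⟩
      1# ∎

    orthogonal⇒inversion : λ₁ n (+ 0) * λ₃ n (+ 0) ≈ 1# →
      (∀ k → 1 ℕ.≤ k → k ℕ.≤ w m n → convolution k ≈ 0#) → X ^ n ≈ₚ expansion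
    orthogonal⇒inversion inv conv≈0 i = sym (begin
      coeff expansion i
        ≈⟨ coeff-expansion i ⟩
      ∑[ k ≤ w m n ] (convolution k * coeff (X ^ (n ℕ.∸ m ℕ.* k)) i)
        -- Condition (i) removes every `k` other than 0, whatever the position `i`.
        ≈⟨ ∑-single (w m n) (λ k → convolution k * coeff (X ^ (n ℕ.∸ m ℕ.* k)) i) z≤n
             (λ k k≤w k≢0 → trans (*-congʳ (conv≈0 k (ℕ.n≢0⇒n>0 k≢0) k≤w)) (zeroˡ _)) ⟩
      convolution 0 * coeff (X ^ (n ℕ.∸ m ℕ.* 0)) i
        ≈⟨ trans (*-congʳ (convolution-zero inv)) (*-identityˡ _) ⟩
      coeff (X ^ (n ℕ.∸ m ℕ.* 0)) i
        ≡⟨ ≡.cong (λ e → coeff (X ^ (n ℕ.∸ e)) i) (ℕ.*-zeroʳ m) ⟩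
      coeff (X ^ n) i ∎)

    -- Compare coefficients at `n ∸ m * k`: the expansion has `convolution k` there, while `X ^ n`
    -- has 0 because this position differs from `n` when `k ≥ 1`.
    inversion⇒orthogonal : X ^ n ≈ₚ expansion →
      ∀ k → 1 ℕ.≤ k → k ℕ.≤ w m n → convolution k ≈ 0#
    inversion⇒orthogonal X^n≈ k 1≤k k≤w = begin
      convolution k                    ≈⟨ coeff-expansion-∸ k≤w ⟨
      coeff expansion (n ℕ.∸ m ℕ.* k)  ≈⟨ X^n≈ _ ⟨
      coeff (X ^ n) (n ℕ.∸ m ℕ.* k)    ≈⟨ coeff-X^-≢ n _ n≢n∸mk ⟩
      0#                               ∎
      where
      n≢n∸mk : n ≢ n ℕ.∸ m ℕ.* k
      -- Reading `n` as `n ∸ m * 0`, injectivity would force `0 ≡ k`.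
      n≢n∸mk eq = ℕ.<⇒≢ 1≤k (∸-*-injective m z≤n k≤w
        (≡.trans (≡.cong (n ℕ.∸_) (ℕ.*-zeroʳ m)) eq))

theorem2p3 :
  ∀ {c ℓ} (R : CommutativeRing c ℓ) →
  let open CommutativeRing R
      open Triangular R in
  (m : ℕ) .{{_ : NonZero m}} (λ₁ λ₃ : Family) →
  Δ m λ₁ → Δ m λ₃ →
  (∀ n → λ₁ n (+ 0) * λ₃ n (+ 0) ≈ 1#) →
  ∀ n →
  (∀ k → 1 ℕ.≤ k → k ℕ.≤ w m n →
    ∑[ b ≤ k ] (λ₃ n (+ b) * λ₁ (n ℕ.∸ m ℕ.* b) (+ k ℤ.- + b)) ≈ 0#)
  ⇔
  (X ^ n ≈ₚ ∑ₚ[ b ≤ w m n ] (λ₃ n (+ b) · f m λ₁ (n ℕ.∸ m ℕ.* b)))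
theorem2p3 R m λ₁ λ₃ _ _ inv n =
  mk⇔ (orthogonal⇒inversion R m λ₁ λ₃ n (inv n)) (inversion⇒orthogonal R m λ₁ λ₃ n)
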